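{- For every integer $d \geq 5$ with $d \neq 7$, the group $H_d$ is uncollapsed.
   Context: For a positive integer $n$, $H_n = \langle a,b,c \mid a^2,b^2,c^2,(ab)^3,(ac)^2,(bc)^n,(bac)^n\rangle$. For positive integers $m,n$ we write $H_m = H_n$ if the two presentations define the same quotient of the free group on $a,b,c$, i.e. the normal closures in the free group of the two sets of relators coincide. $H_d$ is called uncollapsed if $H_d \neq H_k$ for all integers $1 \leq k < d$. -}

module Defs where

open import Data.Nat using (ℕ; zero; suc; _≤_; _<_)
open import Data.Fin using (Fin) renaming (zero to f0; suc to fs)
open import Data.Bool using (Bool; true; false; not)
open import Data.Product using (_×_; _,_)
open import Data.List using (List; []; _∷_; _++_; reverse; map; concat; replicate)
open import Data.List.Membership.Propositional using (_∈_)
open import Relation.Nullary using (¬_)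
open import Function.Bundles using (_⇔_)

-- A letter of the free group on {a, b, c}: a generator (Fin 3) and an
-- exponent sign (true = +1, false = -1).
Letter : Set
Letter = Fin 3 × Bool

-- Words in the generators and their inverses (elements of the free
-- group are words modulo free reduction).
Word : Set
Word = List Letter

letterInv : Letter → Letter
letterInv (x , s) = (x , not s)

wordInv : Word → Word
wordInv w = reverse (map letterInv w)

_^w_ : Word → ℕ → Word
w ^w n = concat (replicate n w)

a b c : Word
a = (f0 , true) ∷ []
b = (fs f0 , true) ∷ []
c = (fs (fs f0) , true) ∷ []

relators : ℕ → List Word
relators n =
  (a ^w 2) ∷ (b ^w 2) ∷ (c ^w 2) ∷ ((a ++ b) ^w 3) ∷ ((a ++ c) ^w 2)
  ∷ ((b ++ c) ^w n) ∷ ((b ++ a ++ c) ^w n) ∷ []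

-- Normal closure of a set of relators R in the free group F(a,b,c),
-- as a predicate on words.  It is closed under free reduction/insertion
-- (so it is a well-defined subset of the free group), contains R, the
-- identity, and is closed under products, inverses and conjugation.
data NormalClosure (R : List Word) : Word → Set where
  rel  : ∀ {r} → r ∈ R → NormalClosure R r
  one  : NormalClosure R []
  mul  : ∀ {u v} → NormalClosure R u → NormalClosure R v → NormalClosure R (u ++ v)
  inv  : ∀ {u} → NormalClosure R u → NormalClosure R (wordInv u)
  conj : ∀ {u} (g : Word) → NormalClosure R u → NormalClosure R (wordInv g ++ u ++ g)
  ins  : ∀ {u v} (x : Letter) → NormalClosure R (u ++ v)
       → NormalClosure R (u ++ x ∷ letterInv x ∷ v)
  del  : ∀ {u v} (x : Letter) → NormalClosure R (u ++ x ∷ letterInv x ∷ v)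
       → NormalClosure R (u ++ v)

SameH : ℕ → ℕ → Set
SameH m n = ∀ (w : Word) → NormalClosure (relators m) w ⇔ NormalClosure (relators n) w

Uncollapsed : ℕ → Set
Uncollapsed d = ∀ k → 1 ≤ k → k < d → ¬ SameH d k

{-# OPTIONS --safe #-}
module Submission where

open import Defs
open import Data.Nat using (ℕ; _≤_)
open import Relation.Binary.PropositionalEquality using (_≢_)
open import Data.Empty using (⊥-elim)
open import Data.Fin using (Fin; toℕ; fromℕ<) renaming (zero to f0; suc to fs)
open import Data.Fin.Properties using (all?; any?; toℕ-fromℕ<) renaming (_≟_ to _≟ᶠ_)
open import Data.List using ([]; _∷_; _++_; map)
open import Data.List.Properties using (unfold-reverse)
open import Data.List.Relation.Unary.Any using (here; there)
open import Data.Nat using (zero; suc; _+_; _∸_; _<_; s≤s; NonZero; _≤?_)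
open import Data.Nat.DivMod using (_mod_)
open import Data.Nat.GeneralisedArithmetic using (fold; fold-+)
open import Data.Nat.Properties using (+-comm; +-suc; +-identityʳ; suc-injective; m∸n+n≡m; m≤n⇒m<n∨m≡n)
open import Data.Nat.Solver using (module +-*-Solver)
open import Data.Product using (_×_; _,_; ∃-syntax; proj₁)
open import Data.Sum using (inj₁; inj₂)
open import Data.Unit using (⊤; tt)
open import Data.Vec as Vec using (Vec; lookup; []; _∷_)
open import Function using (_∘_; Equivalence)
open import Relation.Binary.PropositionalEquality using (_≡_; refl; sym; trans; cong; subst; module ≡-Reasoning)
open import Relation.Nullary using (Dec; ¬?)
open import Relation.Nullary.Decidable using (from-yes; _×-dec_; _→-dec_)

-- If involutions α, β, γ of a set satisfy the relators of H_d and (βγ)^k is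
-- not the identity for 0 < k < d, then (bc)^k is not in the normal closure of
-- those relators, so H_d ≠ H_k.  For d ≤ 10 small permutation groups do.
--
-- For d ≥ 11 the set is built by a free small-cancellation construction.  Its
-- points are the flags of a surface-like complex of triangles: α and β act
-- within a triangle and γ crosses an edge.  The relators (bc)^d and (bac)^d
-- say that the paths which always turn to the same side (L-paths) and the
-- zigzag paths (P-paths) close up after d turns.  Start with one flag fixed by
-- α and β, its edge being unglued, and repeat: glue a new triangle to every unglued edge, then
-- close every L-segment that already existed by a chain of new triangles,
-- then do the same for the old P-segments.  Two different paths share at most
-- one turn, so every segment left open at the end of a round was born in it
-- and has at most 5 turns; with d ≥ 11 the chains of the next round are then
-- long enough not to interfere with each other.  In the limit all paths have
-- period dividing d, and the L-path of the initial flag has period exactly d.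

-- Actions satisfying the relators, and soundness of the normal closure

record Model (d : ℕ) : Set₁ where
  field
    Flag  : Set
    -- The relations are required only on valid flags. This lets the free construction use plain
    -- index data as flags, with no proofs inside the points being compared.
    Valid : Flag → Set
    α β γ : Flag → Flag
    α-valid : ∀ {x} → Valid x → Valid (α x)
    β-valid : ∀ {x} → Valid x → Valid (β x)
    γ-valid : ∀ {x} → Valid x → Valid (γ x)
    αα≡id   : ∀ {x} → Valid x → α (α x) ≡ x
    ββ≡id   : ∀ {x} → Valid x → β (β x) ≡ x
    γγ≡id   : ∀ {x} → Valid x → γ (γ x) ≡ x
    αβ³≡id  : ∀ {x} → Valid x → fold x (α ∘ β) 3 ≡ x
    αγ²≡id  : ∀ {x} → Valid x → fold x (α ∘ γ) 2 ≡ x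
    βγᵈ≡id  : ∀ {x} → Valid x → fold x (β ∘ γ) d ≡ x
    βαγᵈ≡id : ∀ {x} → Valid x → fold x (β ∘ α ∘ γ) d ≡ x

module _ {d : ℕ} (M : Model d) where
  open Model M

  generator : Fin 3 → Flag → Flag
  generator f0           = α
  generator (fs f0)      = β
  generator (fs (fs f0)) = γ

  generator-valid : ∀ g {x} → Valid x → Valid (generator g x)
  generator-valid f0           = α-valid
  generator-valid (fs f0)      = β-valid
  generator-valid (fs (fs f0)) = γ-valid

  generator-involutive : ∀ g {x} → Valid x → generator g (generator g x) ≡ x
  generator-involutive f0           = αα≡id
  generator-involutive (fs f0)      = ββ≡id
  generator-involutive (fs (fs f0)) = γγ≡id

  -- The exponent sign is ignored: generators act by involutions, so a letter and its inverse act
  -- alike.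
  act : Word → Flag → Flag
  act []            x = x
  act ((g , _) ∷ w) x = generator g (act w x)

  act-valid : ∀ w {x} → Valid x → Valid (act w x)
  act-valid []            v = v
  act-valid ((g , _) ∷ w) v = generator-valid g (act-valid w v)

  act-++ : ∀ u w x → act (u ++ w) x ≡ act u (act w x)
  act-++ []            w x = refl
  act-++ ((g , _) ∷ u) w x = cong (generator g) (act-++ u w x)

  act-^w : ∀ u k x → act (u ^w k) x ≡ fold x (act u) k
  act-^w u zero    x = refl
  act-^w u (suc k) x = trans (act-++ u (u ^w k) x) (cong (act u) (act-^w u k x))

  act-wordInv : ∀ w {x} → Valid x → act (wordInv w) (act w x) ≡ x
  act-wordInv []                    v = refl
  act-wordInv ((g , s) ∷ w) {x} v = begin
    act (wordInv ((g , s) ∷ w)) y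
      ≡⟨ cong (λ u → act u y) (unfold-reverse (letterInv (g , s)) (map letterInv w)) ⟩
    act (wordInv w ++ letterInv (g , s) ∷ []) y
      ≡⟨ act-++ (wordInv w) (letterInv (g , s) ∷ []) y ⟩
    act (wordInv w) (generator g y)
      ≡⟨ cong (act (wordInv w)) (generator-involutive g (act-valid w v)) ⟩
    act (wordInv w) (act w x)
      ≡⟨ act-wordInv w v ⟩
    x ∎
    where
    open ≡-Reasoning
    y = generator g (act w x)

  act-cancel : ∀ u ℓ w {x} → Valid x → act (u ++ ℓ ∷ letterInv ℓ ∷ w) x ≡ act (u ++ w) x
  act-cancel u ℓ w {x} v = begin
    act (u ++ ℓ ∷ letterInv ℓ ∷ w) x      ≡⟨ act-++ u (ℓ ∷ letterInv ℓ ∷ w) x ⟩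
    act u (act (ℓ ∷ letterInv ℓ ∷ w) x)   ≡⟨ cong (act u) (generator-involutive (proj₁ ℓ) (act-valid w v)) ⟩
    act u (act w x)                       ≡⟨ sym (act-++ u w x) ⟩
    act (u ++ w) x                        ∎
    where open ≡-Reasoning

  -- The point is quantified after the derivation because the conjugation case uses the induction
  -- hypothesis at `act g x`.
  act-normalClosure : ∀ {w} → NormalClosure (relators d) w → ∀ {x} → Valid x → act w x ≡ x
  act-normalClosure (rel (here refl)) = αα≡id
  act-normalClosure (rel (there (here refl))) = ββ≡id
  act-normalClosure (rel (there (there (here refl)))) = γγ≡id
  act-normalClosure (rel (there (there (there (here refl))))) = αβ³≡id
  act-normalClosure (rel (there (there (there (there (here refl)))))) = αγ²≡id
  act-normalClosure (rel (there (there (there (there (there (here refl))))))) v =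
    trans (act-^w (b ++ c) d _) (βγᵈ≡id v)
  act-normalClosure (rel (there (there (there (there (there (there (here refl)))))))) v =
    trans (act-^w (b ++ a ++ c) d _) (βαγᵈ≡id v)
  act-normalClosure one v = refl
  act-normalClosure (mul {u} {w} p q) {x} v =
    trans (act-++ u w x) (trans (cong (act u) (act-normalClosure q v)) (act-normalClosure p v))
  act-normalClosure (inv {u} p) v =
    trans (cong (act (wordInv u)) (sym (act-normalClosure p v))) (act-wordInv u v)
  act-normalClosure (conj {u} g p) {x} v = begin
    act (wordInv g ++ u ++ g) x         ≡⟨ act-++ (wordInv g) (u ++ g) x ⟩
    act (wordInv g) (act (u ++ g) x)    ≡⟨ cong (act (wordInv g)) (act-++ u g x) ⟩
    act (wordInv g) (act u (act g x))   ≡⟨ cong (act (wordInv g)) (act-normalClosure p (act-valid g v)) ⟩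
    act (wordInv g) (act g x)           ≡⟨ act-wordInv g v ⟩
    x                                   ∎
    where open ≡-Reasoning
  act-normalClosure (ins {u} {w} ℓ p) v = trans (act-cancel u ℓ w v) (act-normalClosure p v)
  act-normalClosure (del {u} {w} ℓ p) v = trans (sym (act-cancel u ℓ w v)) (act-normalClosure p v)

  uncollapsed : (∀ k → 1 ≤ k → k < d → ∃[ x ] Valid x × fold x (β ∘ γ) k ≢ x) → Uncollapsed d
  uncollapsed moved k 1≤k k<d same with moved k 1≤k k<d
  ... | x , v , moves = moves (trans (sym (act-^w (b ++ c) k x)) (act-normalClosure bcᵏ v))
    where
    bcᵏ : NormalClosure (relators d) ((b ++ c) ^w k)
    bcᵏ = Equivalence.from (same _) (rel (there (there (there (there (there (here refl)))))))

-- Finite permutation models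

module _ {m : ℕ} (d : ℕ) (A B C : Vec (Fin m) m) where

  private
    α β γ : Fin m → Fin m
    α = lookup A
    β = lookup B
    γ = lookup C

    Fixes : (Fin m → Fin m) → Set
    Fixes f = ∀ x → f x ≡ x

    fixes? : ∀ f → Dec (Fixes f)
    fixes? f = all? λ x → f x ≟ᶠ x

  RelationsHold : Set
  RelationsHold = Fixes (α ∘ α) × Fixes (β ∘ β) × Fixes (γ ∘ γ)
    × Fixes (λ x → fold x (α ∘ β) 3) × Fixes (λ x → fold x (α ∘ γ) 2)
    × Fixes (λ x → fold x (β ∘ γ) d) × Fixes (λ x → fold x (β ∘ α ∘ γ) d)

  -- The moved point may depend on `k`, so intransitive actions are allowed and no single orbit
  -- needs length `d`.
  OrderExact : Set
  OrderExact = ∀ (k : Fin d) → 1 ≤ toℕ k → ∃[ x ] fold x (β ∘ γ) (toℕ k) ≢ x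

  relationsHold? : Dec RelationsHold
  relationsHold? = fixes? _ ×-dec fixes? _ ×-dec fixes? _
    ×-dec fixes? _ ×-dec fixes? _ ×-dec fixes? _ ×-dec fixes? _

  orderExact? : Dec OrderExact
  orderExact? = all? λ k → (1 ≤? toℕ k) →-dec any? λ x → ¬? (fold x (β ∘ γ) (toℕ k) ≟ᶠ x)

  permutation-uncollapsed : RelationsHold → OrderExact → Uncollapsed d
  permutation-uncollapsed (αα , ββ , γγ , αβ , αγ , βγ , βαγ) exact = uncollapsed M moved
    where
    M : Model d
    M = record
      { Flag = Fin m ; Valid = λ _ → ⊤ ; α = α ; β = β ; γ = γ
      ; α-valid = λ _ → tt ; β-valid = λ _ → tt ; γ-valid = λ _ → tt
      ; αα≡id = λ _ → αα _ ; ββ≡id = λ _ → ββ _ ; γγ≡id = λ _ → γγ _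
      ; αβ³≡id = λ _ → αβ _ ; αγ²≡id = λ _ → αγ _
      ; βγᵈ≡id = λ _ → βγ _ ; βαγᵈ≡id = λ _ → βαγ _
      }

    moved : ∀ k → 1 ≤ k → k < d → ∃[ x ] ⊤ × fold x (β ∘ γ) k ≢ x
    moved k 1≤k k<d with exact (fromℕ< k<d) (subst (1 ≤_) (sym (toℕ-fromℕ< k<d)) 1≤k)
    ... | x , moves = x , tt , subst (λ j → fold x (β ∘ γ) j ≢ x) (toℕ-fromℕ< k<d) moves

perm : ∀ {m} .{{_ : NonZero m}} → Vec ℕ m → Vec (Fin m) m
perm {m} = Vec.map (_mod m)

-- The alternating group on five points, with `bc` a 5-cycle.
uncollapsed-5 : Uncollapsed 5
uncollapsed-5 = permutation-uncollapsed 5 A B C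
  (from-yes (relationsHold? 5 A B C)) (from-yes (orderExact? 5 A B C))
  where
  A = perm (0 ∷ 2 ∷ 1 ∷ 4 ∷ 3 ∷ [])
  B = perm (1 ∷ 0 ∷ 2 ∷ 4 ∷ 3 ∷ [])
  C = perm (0 ∷ 3 ∷ 4 ∷ 1 ∷ 2 ∷ [])

-- S₃ on the points 2, 3, 4 times C₂ on 0, 1; `bc` is a 3-cycle times the swap.
uncollapsed-6 : Uncollapsed 6
uncollapsed-6 = permutation-uncollapsed 6 A B C
  (from-yes (relationsHold? 6 A B C)) (from-yes (orderExact? 6 A B C))
  where
  A = perm (0 ∷ 1 ∷ 2 ∷ 4 ∷ 3 ∷ [])
  B = perm (0 ∷ 1 ∷ 3 ∷ 2 ∷ 4 ∷ [])
  C = perm (1 ∷ 0 ∷ 2 ∷ 4 ∷ 3 ∷ [])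

-- PGL₂(7) on the projective line.
uncollapsed-8 : Uncollapsed 8
uncollapsed-8 = permutation-uncollapsed 8 A B C
  (from-yes (relationsHold? 8 A B C)) (from-yes (orderExact? 8 A B C))
  where
  A = perm (1 ∷ 0 ∷ 3 ∷ 2 ∷ 5 ∷ 4 ∷ 7 ∷ 6 ∷ [])
  B = perm (1 ∷ 0 ∷ 4 ∷ 6 ∷ 2 ∷ 7 ∷ 3 ∷ 5 ∷ [])
  C = perm (2 ∷ 3 ∷ 0 ∷ 1 ∷ 4 ∷ 5 ∷ 7 ∷ 6 ∷ [])

-- PSL₂(19) on the projective line, the point at infinity being 19.
uncollapsed-9 : Uncollapsed 9
uncollapsed-9 = permutation-uncollapsed 9 A B C
  (from-yes (relationsHold? 9 A B C)) (from-yes (orderExact? 9 A B C))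
  where
  A = perm (19 ∷ 18 ∷ 9 ∷ 6 ∷ 14 ∷ 15 ∷ 3 ∷ 8 ∷ 7 ∷ 2 ∷ 17 ∷ 12 ∷ 11 ∷ 16 ∷ 4 ∷ 5 ∷ 13 ∷ 10 ∷ 1 ∷ 0 ∷ [])
  B = perm (4 ∷ 17 ∷ 9 ∷ 13 ∷ 0 ∷ 10 ∷ 11 ∷ 14 ∷ 19 ∷ 2 ∷ 5 ∷ 6 ∷ 16 ∷ 3 ∷ 7 ∷ 18 ∷ 12 ∷ 1 ∷ 15 ∷ 8 ∷ [])
  C = perm (7 ∷ 15 ∷ 13 ∷ 14 ∷ 6 ∷ 18 ∷ 4 ∷ 0 ∷ 19 ∷ 16 ∷ 12 ∷ 17 ∷ 10 ∷ 2 ∷ 3 ∷ 1 ∷ 9 ∷ 11 ∷ 5 ∷ 8 ∷ [])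

-- The model for 5, moved to the points 2 to 6, times C₂ on 0, 1: only `C` swaps these, which
-- doubles the order of `bc`.
uncollapsed-10 : Uncollapsed 10
uncollapsed-10 = permutation-uncollapsed 10 A B C
  (from-yes (relationsHold? 10 A B C)) (from-yes (orderExact? 10 A B C))
  where
  A = perm (0 ∷ 1 ∷ 2 ∷ 4 ∷ 3 ∷ 6 ∷ 5 ∷ [])
  B = perm (0 ∷ 1 ∷ 3 ∷ 2 ∷ 4 ∷ 6 ∷ 5 ∷ [])
  C = perm (1 ∷ 0 ∷ 2 ∷ 5 ∷ 6 ∷ 3 ∷ 4 ∷ [])

-- Orbits of two involutions

module Dihedral {X : Set} (Valid : X → Set) (β κ : X → X)
  (β-valid : ∀ {x} → Valid x → Valid (β x)) (κ-valid : ∀ {x} → Valid x → Valid (κ x))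
  (ββ≡id : ∀ {x} → Valid x → β (β x) ≡ x) (κκ≡id : ∀ {x} → Valid x → κ (κ x) ≡ x) where

  βκ^-valid : ∀ n {x} → Valid x → Valid (fold x (β ∘ κ) n)
  βκ^-valid zero    v = v
  βκ^-valid (suc n) v = β-valid (κ-valid (βκ^-valid n v))

  κβ^-valid : ∀ n {x} → Valid x → Valid (fold x (κ ∘ β) n)
  κβ^-valid zero    v = v
  κβ^-valid (suc n) v = κ-valid (β-valid (κβ^-valid n v))

  fold-shift : ∀ (f : X → X) n x → fold (f x) f n ≡ f (fold x f n)
  fold-shift f zero    x = refl
  fold-shift f (suc n) x = cong f (fold-shift f n x)

  βκ^-κβ^ : ∀ n {x} → Valid x → fold (fold x (κ ∘ β) n) (β ∘ κ) n ≡ x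
  βκ^-κβ^ zero    v = refl
  βκ^-κβ^ (suc n) {x} v = begin
    fold (κ (β y)) (β ∘ κ) (suc n)     ≡⟨ sym (fold-shift (β ∘ κ) n (κ (β y))) ⟩
    fold (β (κ (κ (β y)))) (β ∘ κ) n   ≡⟨ cong (λ ● → fold (β ●) (β ∘ κ) n) (κκ≡id (β-valid vy)) ⟩
    fold (β (β y)) (β ∘ κ) n           ≡⟨ cong (λ ● → fold ● (β ∘ κ) n) (ββ≡id vy) ⟩
    fold y (β ∘ κ) n                   ≡⟨ βκ^-κβ^ n v ⟩
    x                                  ∎
    where
    open ≡-Reasoning
    y  = fold x (κ ∘ β) n
    vy = κβ^-valid n v

  κβ^-β : ∀ n {x} → Valid x → fold (β x) (κ ∘ β) n ≡ β (fold x (β ∘ κ) n)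
  κβ^-β zero    v = refl
  κβ^-β (suc n) {x} v = begin
    κ (β (fold (β x) (κ ∘ β) n))       ≡⟨ cong (κ ∘ β) (κβ^-β n v) ⟩
    κ (β (β (fold x (β ∘ κ) n)))       ≡⟨ cong κ (ββ≡id (βκ^-valid n v)) ⟩
    κ (fold x (β ∘ κ) n)               ≡⟨ sym (ββ≡id (κ-valid (βκ^-valid n v))) ⟩
    β (β (κ (fold x (β ∘ κ) n)))       ∎
    where open ≡-Reasoning

  κβ^-κ : ∀ n x → fold (κ x) (κ ∘ β) n ≡ κ (fold x (β ∘ κ) n)
  κβ^-κ zero    x = refl
  κβ^-κ (suc n) x = cong (κ ∘ β) (κβ^-κ n x)

  module _ (d : ℕ) where

    Closed : X → Set
    Closed x = fold x (κ ∘ β) d ≡ x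

    closed⇒βκᵈ : ∀ {x} → Valid x → Closed x → fold x (β ∘ κ) d ≡ x
    closed⇒βκᵈ v h = trans (cong (λ ● → fold ● (β ∘ κ) d) (sym h)) (βκ^-κβ^ d v)

    -- Conjugation by `β` inverts `κ ∘ β`, so closedness passes along the whole dihedral orbit and
    -- one flag per orbit suffices.
    closed-β⁻ : ∀ {x} → Valid x → Closed (β x) → Closed x
    closed-β⁻ {x} v h = subst Closed (ββ≡id v)
      (trans (κβ^-β d (β-valid v)) (cong β (closed⇒βκᵈ (β-valid v) h)))

    closed-κ⁻ : ∀ {x} → Valid x → Closed (κ x) → Closed x
    closed-κ⁻ {x} v h = subst Closed (κκ≡id v)
      (trans (κβ^-κ d (κ x)) (cong κ (closed⇒βκᵈ (κ-valid v) h)))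

-- The free construction

module FreeModel (n : ℕ) where

  -- A stub is a flag on an edge that is unglued at the end of some round.  The
  -- next round closes the L-segment and the P-segment starting at a stub s by
  -- chains of triangles whose outer edges carry the stubs sideL s i j and
  -- sideP s i j, at i steps from the start and j steps from the end of the
  -- chain; the first and last triangles of an L-chain are glued to P-chains in
  -- the same round and are not counted.  Reversing a chain swaps i and j.
  data Stub : Set where
    root        : Stub
    sideL sideP : Stub → ℕ → ℕ → Stub

  -- 5 minus the number of turns of the open L- and P-segments at a stub.
  slackL slackP : Stub → ℕ
  slackL root                      = 4
  slackL (sideL s zero j)          = 1
  slackL (sideL s (suc i) j)       = 3
  slackL (sideP s zero j)          = 0
  slackL (sideP s (suc zero) j)    = 1
  slackL (sideP s (suc (suc i)) j) = 2
  slackP root                      = 4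
  slackP (sideL s zero j)          = 0
  slackP (sideL s (suc zero) j)    = 1
  slackP (sideL s (suc (suc i)) j) = 2
  slackP (sideP s zero j)          = 1
  slackP (sideP s (suc i) j)       = 3

  -- One less than the number of triangles in the chain that brings a segment
  -- to 11 + n turns: the P-chain is shorter by 2 because the L-chains have
  -- already lengthened the P-segment by one turn at each end.
  spanL spanP : Stub → ℕ
  spanL s = 3 + (n + slackL s)
  spanP s = 1 + (n + slackP s)

  -- flip is α on stubs; mateL and mateP give the other end of a segment.
  flip mateL mateP : Stub → Stub
  flip root          = root
  flip (sideL s i j) = sideL (mateL s) j i
  flip (sideP s i j) = sideP (mateP s) j i
  mateL root                      = root
  -- A segment leaving a chain at its start runs into a chain starting at `flip s`; the last index
  -- is then forced by validity.
  mateL (sideL s zero j)          = sideP (flip s) 1 (n + slackP (flip s))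
  -- Away from the start, the L-segments of an L-chain join neighbouring stubs and its P-segments
  -- join stubs two steps apart; in a P-chain it is the other way round. The partner is named from
  -- the opposite end.
  mateL (sideL s (suc i) j)       = sideL (mateL s) (suc j) i
  mateL (sideP s zero j)          = sideP (flip s) 0 (1 + (n + slackP (flip s)))
  mateL (sideP s (suc zero) j)    = sideL (flip s) 0 (1 + (n + slackL (flip s)))
  mateL (sideP s (suc (suc i)) j) = sideP (mateP s) (2 + j) i
  mateP root                      = root
  mateP (sideL s zero j)          = sideL (flip s) 0 (1 + (n + slackL (flip s)))
  mateP (sideL s (suc zero) j)    = sideP (flip s) 0 (1 + (n + slackP (flip s)))
  mateP (sideL s (suc (suc i)) j) = sideL (mateL s) (2 + j) i
  mateP (sideP s zero j)          = sideL (flip s) 1 (n + slackL (flip s))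
  mateP (sideP s (suc i) j)       = sideP (mateP s) (suc j) i

  -- Valid stubs and the involutions on them

  ValidStub : Stub → Set
  ValidStub root          = ⊤
  -- The sum is `spanL s` minus 2, both end triangles being left out; for a P-chain it is all of
  -- `spanP s`.
  ValidStub (sideL s i j) = ValidStub s × i + j ≡ 1 + (n + slackL s)
  ValidStub (sideP s i j) = ValidStub s × i + j ≡ 1 + (n + slackP s)

  -- Thanks to this symmetry a closing chain has the same span from either end.
  slackL-mateL : ∀ s → slackL (mateL s) ≡ slackL s
  slackL-mateL root                      = refl
  slackL-mateL (sideL s zero j)          = refl
  slackL-mateL (sideL s (suc i) j)       = refl
  slackL-mateL (sideP s zero j)          = refl
  slackL-mateL (sideP s (suc zero) j)    = refl
  slackL-mateL (sideP s (suc (suc i)) j) = refl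

  slackP-mateP : ∀ s → slackP (mateP s) ≡ slackP s
  slackP-mateP root                      = refl
  slackP-mateP (sideL s zero j)          = refl
  slackP-mateP (sideL s (suc zero) j)    = refl
  slackP-mateP (sideL s (suc (suc i)) j) = refl
  slackP-mateP (sideP s zero j)          = refl
  slackP-mateP (sideP s (suc i) j)       = refl

  swap : ∀ i j {k} → i + j ≡ k → j + i ≡ k
  swap i j p = trans (+-comm j i) p

  cross : ∀ i j {k} → suc i + j ≡ k → suc j + i ≡ k
  cross i j p = trans (cong suc (+-comm j i)) p

  flip-valid  : ∀ s → ValidStub s → ValidStub (flip s)
  mateL-valid : ∀ s → ValidStub s → ValidStub (mateL s)
  mateP-valid : ∀ s → ValidStub s → ValidStub (mateP s)
  flip-valid root          v       = tt
  flip-valid (sideL s i j) (v , p) rewrite slackL-mateL s = mateL-valid s v , swap i j p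
  flip-valid (sideP s i j) (v , p) rewrite slackP-mateP s = mateP-valid s v , swap i j p
  mateL-valid root                      v       = tt
  mateL-valid (sideL s zero j)          (v , p) = flip-valid s v , refl
  mateL-valid (sideL s (suc i) j)       (v , p) rewrite slackL-mateL s = mateL-valid s v , cross i j p
  mateL-valid (sideP s zero j)          (v , p) = flip-valid s v , refl
  mateL-valid (sideP s (suc zero) j)    (v , p) = flip-valid s v , refl
  mateL-valid (sideP s (suc (suc i)) j) (v , p) rewrite slackP-mateP s =
    mateP-valid s v , trans (cong (2 +_) (+-comm j i)) p
  mateP-valid root                      v       = tt
  mateP-valid (sideL s zero j)          (v , p) = flip-valid s v , refl
  mateP-valid (sideL s (suc zero) j)    (v , p) = flip-valid s v , refl
  mateP-valid (sideL s (suc (suc i)) j) (v , p) rewrite slackL-mateL s =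
    mateL-valid s v , trans (cong (2 +_) (+-comm j i)) p
  mateP-valid (sideP s zero j)          (v , p) = flip-valid s v , refl
  mateP-valid (sideP s (suc i) j)       (v , p) rewrite slackP-mateP s = mateP-valid s v , cross i j p

  -- A joint induction: each case reduces to one of the three laws at the older stub `s`.
  flip-flip   : ∀ s → ValidStub s → flip (flip s) ≡ s
  mateL-mateL : ∀ s → ValidStub s → mateL (mateL s) ≡ s
  mateP-mateP : ∀ s → ValidStub s → mateP (mateP s) ≡ s
  flip-flip root          v       = refl
  flip-flip (sideL s i j) (v , p) rewrite mateL-mateL s v = refl
  flip-flip (sideP s i j) (v , p) rewrite mateP-mateP s v = refl
  mateL-mateL root                      v       = refl
  -- At the start of a chain the mate forgets `j`, which the validity equation `p` restores.
  mateL-mateL (sideL s zero j)          (v , p) rewrite flip-flip s v | p = refl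
  mateL-mateL (sideL s (suc i) j)       (v , p) rewrite mateL-mateL s v = refl
  mateL-mateL (sideP s zero j)          (v , p) rewrite flip-flip s v | p = refl
  mateL-mateL (sideP s (suc zero) j)    (v , p) rewrite flip-flip s v | suc-injective p = refl
  mateL-mateL (sideP s (suc (suc i)) j) (v , p) rewrite mateP-mateP s v = refl
  mateP-mateP root                      v       = refl
  mateP-mateP (sideL s zero j)          (v , p) rewrite flip-flip s v | p = refl
  mateP-mateP (sideL s (suc zero) j)    (v , p) rewrite flip-flip s v | suc-injective p = refl
  mateP-mateP (sideL s (suc (suc i)) j) (v , p) rewrite mateL-mateL s v = refl
  mateP-mateP (sideP s zero j)          (v , p) rewrite flip-flip s v | p = refl
  mateP-mateP (sideP s (suc i) j)       (v , p) rewrite mateP-mateP s v = refl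

  -- For a stub s, the triangle glued to its edge has the flags e s (glued to
  -- s), y s, w s and those of flip s.  The triangles of the L-chain have flags
  -- z (on the face being closed), u = α z and t = β u (on the outer edge); z′, u′, t′ are those of the P-chain, which starts at the flag
  -- t (flip s) 0 _.  No choice of orientation of the chains is needed, since
  -- the remaining three flags of a triangle are named from the other end.
  data Flag : Set where
    base            : Flag
    e y w           : Stub → Flag
    z u t z′ u′ t′  : Stub → ℕ → ℕ → Flag

  flag : Stub → Flag
  flag root          = base
  flag (sideL s i j) = t s (suc i) (suc j)
  flag (sideP s i j) = t′ s i j

  Valid : Flag → Set
  Valid base       = ⊤
  Valid (e s)      = ValidStub s
  Valid (y s)      = ValidStub s
  Valid (w s)      = ValidStub s
  Valid (z s i j)  = ValidStub s × i + j ≡ spanL s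
  Valid (u s i j)  = ValidStub s × i + j ≡ spanL s
  Valid (t s i j)  = ValidStub s × i + j ≡ spanL s
  Valid (z′ s i j) = ValidStub s × i + j ≡ spanP s
  Valid (u′ s i j) = ValidStub s × i + j ≡ spanP s
  Valid (t′ s i j) = ValidStub s × i + j ≡ spanP s

  α β γ δ : Flag → Flag
  α base       = base
  α (e s)      = e (flip s)
  α (y s)      = w s
  α (w s)      = y s
  α (z s i j)  = u s i j
  α (u s i j)  = z s i j
  α (t s i j)  = t (mateL s) j i
  α (z′ s i j) = u′ s i j
  α (u′ s i j) = z′ s i j
  α (t′ s i j) = t′ (mateP s) j i

  β base       = base
  β (e s)      = y s
  β (y s)      = e s
  β (w s)      = w (flip s)
  β (z s i j)  = z (mateL s) j i
  β (u s i j)  = t s i j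
  β (t s i j)  = u s i j
  β (z′ s i j) = z′ (mateP s) j i
  β (u′ s i j) = t′ s i j
  β (t′ s i j) = u′ s i j

  γ base                  = e root
  γ (e s)                 = flag s
  γ (y s)                 = z s 0 (spanL s)
  γ (w s)                 = u s 0 (spanL s)
  γ (z s zero j)          = y s
  γ (z s (suc i) j)       = z (mateL s) (suc j) i
  γ (u s zero j)          = w s
  γ (u s (suc i) j)       = u (mateL s) (suc j) i
  -- The outer edge of the first triangle of an L-chain carries the start of a P-chain; the next
  -- clause is the same gluing seen from the far end.
  γ (t s zero j)          = u′ (flip s) 0 (spanP (flip s))
  γ (t s (suc i) zero)    = z′ (flip (mateL s)) 0 (spanP (flip (mateL s)))
  γ (t s (suc i) (suc j)) = e (sideL s i j)
  γ (z′ s zero j)         = t (mateL (flip s)) (spanL (flip s)) 0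
  -- Here `γ` exchanges the `z′` and `u′` sides, so that `δ` preserves the `z′` side and the closed
  -- face is a zigzag.
  γ (z′ s (suc i) j)      = u′ (mateP s) (suc j) i
  γ (u′ s zero j)         = t (flip s) 0 (spanL (flip s))
  γ (u′ s (suc i) j)      = z′ (mateP s) (suc j) i
  γ (t′ s i j)            = e (sideP s i j)

  -- P-paths cross edges by δ the way L-paths cross them by γ.
  δ = α ∘ γ

  -- The relators of fixed exponent

  flag-valid : ∀ s → ValidStub s → Valid (flag s)
  flag-valid root          v       = tt
  flag-valid (sideL s i j) (v , p) = v , cong suc (trans (+-suc i j) (cong suc p))
  flag-valid (sideP s i j) v       = v

  α-flag : ∀ s → α (flag s) ≡ flag (flip s)
  α-flag root          = refl
  α-flag (sideL s i j) = refl
  α-flag (sideP s i j) = refl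

  γ-flag : ∀ s → γ (flag s) ≡ e s
  γ-flag root          = refl
  γ-flag (sideL s i j) = refl
  γ-flag (sideP s i j) = refl

  α-valid : ∀ x → Valid x → Valid (α x)
  α-valid base       v       = tt
  α-valid (e s)      v       = flip-valid s v
  α-valid (y s)      v       = v
  α-valid (w s)      v       = v
  α-valid (z s i j)  v       = v
  α-valid (u s i j)  v       = v
  α-valid (t s i j)  (v , p) rewrite slackL-mateL s = mateL-valid s v , swap i j p
  α-valid (z′ s i j) v       = v
  α-valid (u′ s i j) v       = v
  α-valid (t′ s i j) (v , p) rewrite slackP-mateP s = mateP-valid s v , swap i j p

  β-valid : ∀ x → Valid x → Valid (β x)
  β-valid base       v       = tt
  β-valid (e s)      v       = v
  β-valid (y s)      v       = v
  β-valid (w s)      v       = flip-valid s v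
  β-valid (z s i j)  (v , p) rewrite slackL-mateL s = mateL-valid s v , swap i j p
  β-valid (u s i j)  v       = v
  β-valid (t s i j)  v       = v
  β-valid (z′ s i j) (v , p) rewrite slackP-mateP s = mateP-valid s v , swap i j p
  β-valid (u′ s i j) v       = v
  β-valid (t′ s i j) v       = v

  γ-valid : ∀ x → Valid x → Valid (γ x)
  γ-valid base                  v       = tt
  γ-valid (e s)                 v       = flag-valid s v
  γ-valid (y s)                 v       = v , refl
  γ-valid (w s)                 v       = v , refl
  γ-valid (z s zero j)          (v , p) = v
  γ-valid (z s (suc i) j)       (v , p) rewrite slackL-mateL s = mateL-valid s v , cross i j p
  γ-valid (u s zero j)          (v , p) = v
  γ-valid (u s (suc i) j)       (v , p) rewrite slackL-mateL s = mateL-valid s v , cross i j p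
  γ-valid (t s zero j)          (v , p) = flip-valid s v , refl
  γ-valid (t s (suc i) zero)    (v , p) = flip-valid (mateL s) (mateL-valid s v) , refl
  γ-valid (t s (suc i) (suc j)) (v , p) = v , suc-injective (trans (sym (+-suc i j)) (suc-injective p))
  γ-valid (z′ s zero j)         (v , p) rewrite slackL-mateL (flip s) =
    mateL-valid (flip s) (flip-valid s v) , +-identityʳ _
  γ-valid (z′ s (suc i) j)      (v , p) rewrite slackP-mateP s = mateP-valid s v , cross i j p
  γ-valid (u′ s zero j)         (v , p) = flip-valid s v , refl
  γ-valid (u′ s (suc i) j)      (v , p) rewrite slackP-mateP s = mateP-valid s v , cross i j p
  γ-valid (t′ s i j)            v       = v

  δ-valid : ∀ x → Valid x → Valid (δ x)
  δ-valid x v = α-valid (γ x) (γ-valid x v)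

  αα≡id : ∀ x → Valid x → α (α x) ≡ x
  αα≡id base       v       = refl
  αα≡id (e s)      v       = cong e (flip-flip s v)
  αα≡id (y s)      v       = refl
  αα≡id (w s)      v       = refl
  αα≡id (z s i j)  v       = refl
  αα≡id (u s i j)  v       = refl
  αα≡id (t s i j)  (v , p) = cong (λ ● → t ● i j) (mateL-mateL s v)
  αα≡id (z′ s i j) v       = refl
  αα≡id (u′ s i j) v       = refl
  αα≡id (t′ s i j) (v , p) = cong (λ ● → t′ ● i j) (mateP-mateP s v)

  ββ≡id : ∀ x → Valid x → β (β x) ≡ x
  ββ≡id base       v       = refl
  ββ≡id (e s)      v       = refl
  ββ≡id (y s)      v       = refl
  ββ≡id (w s)      v       = cong w (flip-flip s v)
  ββ≡id (z s i j)  (v , p) = cong (λ ● → z ● i j) (mateL-mateL s v)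
  ββ≡id (u s i j)  v       = refl
  ββ≡id (t s i j)  v       = refl
  ββ≡id (z′ s i j) (v , p) = cong (λ ● → z′ ● i j) (mateP-mateP s v)
  ββ≡id (u′ s i j) v       = refl
  ββ≡id (t′ s i j) v       = refl

  γγ≡id : ∀ x → Valid x → γ (γ x) ≡ x
  γγ≡id base                  v       = refl
  γγ≡id (e s)                 v       = γ-flag s
  γγ≡id (y s)                 v       = refl
  γγ≡id (w s)                 v       = refl
  γγ≡id (z s zero j)          (v , p) = cong (z s 0) (sym p)
  γγ≡id (z s (suc i) j)       (v , p) = cong (λ ● → z ● (suc i) j) (mateL-mateL s v)
  γγ≡id (u s zero j)          (v , p) = cong (u s 0) (sym p)
  γγ≡id (u s (suc i) j)       (v , p) = cong (λ ● → u ● (suc i) j) (mateL-mateL s v)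
  γγ≡id (t s zero j)          (v , p) rewrite flip-flip s v = cong (t s 0) (sym p)
  γγ≡id (t s (suc i) zero)    (v , p)
    rewrite flip-flip (mateL s) (mateL-valid s v) | mateL-mateL s v | slackL-mateL s
    = cong (λ ● → t s ● 0) (trans (sym p) (+-identityʳ _))
  γγ≡id (t s (suc i) (suc j)) v       = refl
  γγ≡id (z′ s zero j)         (v , p)
    rewrite mateL-mateL (flip s) (flip-valid s v) | flip-flip s v = cong (z′ s 0) (sym p)
  γγ≡id (z′ s (suc i) j)      (v , p) = cong (λ ● → z′ ● (suc i) j) (mateP-mateP s v)
  γγ≡id (u′ s zero j)         (v , p) rewrite flip-flip s v = cong (u′ s 0) (sym p)
  γγ≡id (u′ s (suc i) j)      (v , p) = cong (λ ● → u′ ● (suc i) j) (mateP-mateP s v)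
  γγ≡id (t′ s i j)            v       = refl

  αγ≡γα : ∀ x → Valid x → α (γ x) ≡ γ (α x)
  αγ≡γα base                  v       = refl
  αγ≡γα (e s)                 v       = α-flag s
  αγ≡γα (y s)                 v       = refl
  αγ≡γα (w s)                 v       = refl
  αγ≡γα (z s zero j)          v       = refl
  αγ≡γα (z s (suc i) j)       v       = refl
  αγ≡γα (u s zero j)          v       = refl
  αγ≡γα (u s (suc i) j)       v       = refl
  αγ≡γα (t s zero zero)       (v , ())
  αγ≡γα (t s zero (suc j))    (v , p) rewrite mateL-mateL s v = refl
  αγ≡γα (t s (suc i) zero)    v       = refl
  αγ≡γα (t s (suc i) (suc j)) v       = refl
  αγ≡γα (z′ s zero j)         (v , p) rewrite mateL-mateL (flip s) (flip-valid s v) = refl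
  αγ≡γα (z′ s (suc i) j)      v       = refl
  αγ≡γα (u′ s zero j)         v       = refl
  αγ≡γα (u′ s (suc i) j)      v       = refl
  αγ≡γα (t′ s i j)            v       = refl

  δδ≡id : ∀ x → Valid x → δ (δ x) ≡ x
  δδ≡id x v = begin
    α (γ (α (γ x))) ≡⟨ cong (α ∘ γ) (αγ≡γα x v) ⟩
    α (γ (γ (α x))) ≡⟨ cong α (γγ≡id (α x) (α-valid x v)) ⟩
    α (α x)         ≡⟨ αα≡id x v ⟩
    x               ∎
    where open ≡-Reasoning

  αβ³≡id : ∀ x → Valid x → fold x (α ∘ β) 3 ≡ x
  αβ³≡id base       v       = refl
  αβ³≡id (e s)      v       = cong e (flip-flip s v)
  αβ³≡id (y s)      v       = cong y (flip-flip s v)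
  αβ³≡id (w s)      v       = cong w (flip-flip s v)
  αβ³≡id (z s i j)  (v , p) = cong (λ ● → z ● i j) (mateL-mateL s v)
  αβ³≡id (u s i j)  (v , p) = cong (λ ● → u ● i j) (mateL-mateL s v)
  αβ³≡id (t s i j)  (v , p) = cong (λ ● → t ● i j) (mateL-mateL s v)
  αβ³≡id (z′ s i j) (v , p) = cong (λ ● → z′ ● i j) (mateP-mateP s v)
  αβ³≡id (u′ s i j) (v , p) = cong (λ ● → u′ ● i j) (mateP-mateP s v)
  αβ³≡id (t′ s i j) (v , p) = cong (λ ● → t′ ● i j) (mateP-mateP s v)

  -- Closing the open segments in `11 + n` turns

  lengthL lengthP : Stub → ℕ
  lengthL s = 5 ∸ slackL s
  lengthP s = 5 ∸ slackP s

  segmentL : ∀ s → ValidStub s → fold (flag s) (γ ∘ β) (lengthL s) ≡ e (mateL s)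
  segmentL root                      v       = refl
  segmentL (sideL s zero j)          (v , p)
    rewrite mateL-mateL s v | mateP-mateP (flip s) (flip-valid s v) = refl
  segmentL (sideL s (suc i) j)       (v , p) = refl
  segmentL (sideP s zero j)          (v , p) rewrite flip-flip s v = refl
  segmentL (sideP s (suc zero) j)    (v , p)
    rewrite mateP-mateP s v | mateL-mateL (flip s) (flip-valid s v) = refl
  segmentL (sideP s (suc (suc i)) j) (v , p) rewrite mateP-mateP s v = refl

  -- The `flip` arises because the last edge is crossed by `δ` rather than `γ`.
  segmentP : ∀ s → ValidStub s → fold (flag s) (δ ∘ β) (lengthP s) ≡ e (flip (mateP s))
  segmentP root                      v       = refl
  segmentP (sideL s zero j)          (v , p)
    rewrite mateL-mateL s v | mateL-mateL (flip s) (flip-valid s v) = refl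
  segmentP (sideL s (suc zero) j)    (v , p)
    rewrite mateL-mateL s v | mateL-mateL s v = refl
  segmentP (sideL s (suc (suc i)) j) (v , p)
    rewrite mateL-mateL s v | mateL-mateL s v = refl
  segmentP (sideP s zero j)          (v , p)
    rewrite mateL-mateL (flip s) (flip-valid s v) | mateL-mateL (flip s) (flip-valid s v) = refl
  segmentP (sideP s (suc i) j)       (v , p) = refl

  -- A turn reads the chain from the other end twice, once in `β` and once in `γ`, so the two mates
  -- cancel and it advances by one triangle.
  faceL : ∀ s → ValidStub s → ∀ k j → fold (z s 0 (k + j)) (γ ∘ β) k ≡ z s k j
  faceL s v zero    j = refl
  faceL s v (suc k) j
    rewrite sym (+-suc k j) | faceL s v k (suc j) | mateL-mateL s v = refl

  faceP : ∀ s → ValidStub s → ∀ k j → fold (z′ s 0 (k + j)) (δ ∘ β) k ≡ z′ s k j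
  faceP s v zero    j = refl
  faceP s v (suc k) j
    rewrite sym (+-suc k j) | faceP s v k (suc j) | mateP-mateP s v = refl

  slackL+lengthL : ∀ s → slackL s + lengthL s ≡ 5
  slackL+lengthL root                      = refl
  slackL+lengthL (sideL s zero j)          = refl
  slackL+lengthL (sideL s (suc i) j)       = refl
  slackL+lengthL (sideP s zero j)          = refl
  slackL+lengthL (sideP s (suc zero) j)    = refl
  slackL+lengthL (sideP s (suc (suc i)) j) = refl

  slackP+lengthP : ∀ s → slackP s + lengthP s ≡ 5
  slackP+lengthP root                      = refl
  slackP+lengthP (sideL s zero j)          = refl
  slackP+lengthP (sideL s (suc zero) j)    = refl
  slackP+lengthP (sideL s (suc (suc i)) j) = refl
  slackP+lengthP (sideP s zero j)          = refl
  slackP+lengthP (sideP s (suc i) j)       = refl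

  turns : ∀ m σ ℓ → σ + ℓ ≡ 5 → (n + σ) + (m + ℓ) ≡ m + (5 + n)
  turns m σ ℓ σ+ℓ≡5 = begin
    (n + σ) + (m + ℓ) ≡⟨ solve 4 (λ n σ m ℓ → (n :+ σ) :+ (m :+ ℓ) := m :+ ((σ :+ ℓ) :+ n)) refl n σ m ℓ ⟩
    m + ((σ + ℓ) + n) ≡⟨ cong (λ ● → m + (● + n)) σ+ℓ≡5 ⟩
    m + (5 + n)       ∎
    where
    open ≡-Reasoning
    open +-*-Solver

  cycleL : ∀ s → ValidStub s → fold (flag s) (γ ∘ β) (11 + n) ≡ flag s
  cycleL s v = begin
    fold (flag s) T (11 + n)
      -- The turns are `lengthL s` in the old segment, one in the triangle glued at its far end,
      -- `spanL s` along the chain, then one in the last chain triangle and one in the triangle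
      -- glued at `s`.
      ≡⟨ cong (fold (flag s) T) (sym (cong (5 +_) (turns 1 (slackL s) (lengthL s) (slackL+lengthL s)))) ⟩
    T (T (fold (flag s) T (spanL s + suc (lengthL s))))
      ≡⟨ cong (T ∘ T) (fold-+ (flag s) T (spanL s)) ⟩
    T (T (fold (T (fold (flag s) T (lengthL s))) T (spanL s)))
      ≡⟨ cong (λ ● → T (T (fold (T ●) T (spanL s)))) (segmentL s v) ⟩
    T (T (fold (z (mateL s) 0 (spanL (mateL s))) T (spanL s)))
      ≡⟨ cong (λ ● → T (T (fold (z (mateL s) 0 (3 + (n + ●))) T (spanL s)))) (slackL-mateL s) ⟩
    T (T (fold (z (mateL s) 0 (spanL s)) T (spanL s)))
      ≡⟨ cong (λ ● → T (T (fold (z (mateL s) 0 ●) T (spanL s)))) (sym (+-identityʳ (spanL s))) ⟩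
    T (T (fold (z (mateL s) 0 (spanL s + 0)) T (spanL s)))
      ≡⟨ cong (T ∘ T) (faceL (mateL s) (mateL-valid s v) (spanL s) 0) ⟩
    flag (mateL (mateL s))
      ≡⟨ cong flag (mateL-mateL s v) ⟩
    flag s ∎
    where
    open ≡-Reasoning
    T = γ ∘ β

  cycleP : ∀ s → ValidStub s → fold (flag s) (δ ∘ β) (11 + n) ≡ flag s
  cycleP s v = begin
    fold (flag s) T (11 + n)
      -- Compared with the L-case, the path makes one more turn on the way in and one more on the
      -- way out, each in an end triangle of an L-chain.
      ≡⟨ cong (fold (flag s) T) (sym (cong (4 +_) (turns 2 (slackP s) (lengthP s) (slackP+lengthP s)))) ⟩
    T (T (T (fold (flag s) T (spanP s + (2 + lengthP s)))))
      ≡⟨ cong (T ∘ T ∘ T) (fold-+ (flag s) T (spanP s)) ⟩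
    T (T (T (fold (T (T (fold (flag s) T (lengthP s)))) T (spanP s))))
      ≡⟨ cong (λ ● → T (T (T (fold (T (T ●)) T (spanP s))))) (segmentP s v) ⟩
    T (T (T (fold (z′ (flip (flip (mateP s))) 0 (spanP (flip (flip (mateP s))))) T (spanP s))))
      ≡⟨ cong (λ ● → T (T (T (fold (z′ ● 0 (spanP ●)) T (spanP s))))) (flip-flip (mateP s) (mateP-valid s v)) ⟩
    T (T (T (fold (z′ (mateP s) 0 (spanP (mateP s))) T (spanP s))))
      ≡⟨ cong (λ ● → T (T (T (fold (z′ (mateP s) 0 (1 + (n + ●))) T (spanP s))))) (slackP-mateP s) ⟩
    T (T (T (fold (z′ (mateP s) 0 (spanP s)) T (spanP s))))
      ≡⟨ cong (λ ● → T (T (T (fold (z′ (mateP s) 0 ●) T (spanP s))))) (sym (+-identityʳ (spanP s))) ⟩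
    T (T (T (fold (z′ (mateP s) 0 (spanP s + 0)) T (spanP s))))
      ≡⟨ cong (T ∘ T ∘ T) (faceP (mateP s) (mateP-valid s v) (spanP s) 0) ⟩
    α (flag (mateL (mateL (flip (mateP (mateP s))))))
      ≡⟨ cong (λ ● → α (flag (mateL (mateL (flip ●))))) (mateP-mateP s v) ⟩
    α (flag (mateL (mateL (flip s))))
      ≡⟨ cong (α ∘ flag) (mateL-mateL (flip s) (flip-valid s v)) ⟩
    α (flag (flip s))
      ≡⟨ α-flag (flip s) ⟩
    flag (flip (flip s))
      ≡⟨ cong flag (flip-flip s v) ⟩
    flag s ∎
    where
    open ≡-Reasoning
    T = δ ∘ β

  -- Every path meets a closed one: spreading closedness to all flags

  module L = Dihedral Valid β γ
    (λ {x} → β-valid x) (λ {x} → γ-valid x) (λ {x} → ββ≡id x) (λ {x} → γγ≡id x)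
  module P = Dihedral Valid β δ
    (λ {x} → β-valid x) (λ {x} → δ-valid x) (λ {x} → ββ≡id x) (λ {x} → δδ≡id x)

  ClosedL ClosedP : Flag → Set
  ClosedL = L.Closed (11 + n)
  ClosedP = P.Closed (11 + n)

  -- The continuation form threads validity through successive steps along a path.
  closedL-β : ∀ {x} → Valid x → (Valid (β x) → ClosedL (β x)) → ClosedL x
  closedL-β {x} v h = L.closed-β⁻ (11 + n) v (h (β-valid x v))

  closedL-γ : ∀ {x} → Valid x → (Valid (γ x) → ClosedL (γ x)) → ClosedL x
  closedL-γ {x} v h = L.closed-κ⁻ (11 + n) v (h (γ-valid x v))

  closedP-β : ∀ {x} → Valid x → (Valid (β x) → ClosedP (β x)) → ClosedP x
  closedP-β {x} v h = P.closed-β⁻ (11 + n) v (h (β-valid x v))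

  closedP-δ : ∀ {x} → Valid x → (Valid (δ x) → ClosedP (δ x)) → ClosedP x
  closedP-δ {x} v h = P.closed-κ⁻ (11 + n) v (h (δ-valid x v))

  closedL-e : ∀ s → ValidStub s → ClosedL (e s)
  closedL-e s v = closedL-γ v λ _ → cycleL s v

  closedL-t′ : ∀ s i j → Valid (t′ s i j) → ClosedL (t′ s i j)
  closedL-t′ s i j = cycleL (sideP s i j)

  closedL-u′ : ∀ s i j → Valid (u′ s i j) → ClosedL (u′ s i j)
  closedL-u′ s i j v = closedL-β v (closedL-t′ s i j)

  closedL-z′ : ∀ s i j → Valid (z′ s i j) → ClosedL (z′ s i j)
  closedL-z′ s (suc i) j       v = closedL-γ v (closedL-u′ _ _ _)
  closedL-z′ s zero    (suc j) v = closedL-β v λ v → closedL-γ v (closedL-u′ _ _ _)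
  closedL-z′ s zero    zero    (_ , ())

  closedL-t : ∀ s i j → Valid (t s i j) → ClosedL (t s i j)
  closedL-t s zero    j       v = closedL-γ v (closedL-u′ _ _ _)
  closedL-t s (suc i) zero    v = closedL-γ v (closedL-z′ _ _ _)
  closedL-t s (suc i) (suc j) v = cycleL (sideL s i j) (γ-valid (t s (suc i) (suc j)) v)

  closedL-z : ∀ s i j → Valid (z s i j) → ClosedL (z s i j)
  closedL-z s zero    j v = closedL-γ v λ v → closedL-β v (closedL-e s)
  -- Crossing and turning moves one triangle back, so `i` decreases until the start of the chain.
  closedL-z s (suc i) j v = closedL-γ v λ v → closedL-β v (closedL-z _ i _)

  closedL : ∀ x → Valid x → ClosedL x
  closedL base       v = cycleL root v
  closedL (e s)      v = closedL-e s v
  closedL (y s)      v = closedL-β v (closedL-e s)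
  closedL (w s)      v = closedL-γ v λ v → closedL-β v (closedL-t _ _ _)
  closedL (z s i j)  v = closedL-z s i j v
  closedL (u s i j)  v = closedL-β v (closedL-t s i j)
  closedL (t s i j)  v = closedL-t s i j v
  closedL (z′ s i j) v = closedL-z′ s i j v
  closedL (u′ s i j) v = closedL-u′ s i j v
  closedL (t′ s i j) v = closedL-t′ s i j v

  closedP-e : ∀ s → ValidStub s → ClosedP (e s)
  closedP-e s v = closedP-δ v λ _ →
    subst ClosedP (sym (α-flag s)) (cycleP (flip s) (flip-valid s v))

  closedP-y : ∀ s → ValidStub s → ClosedP (y s)
  closedP-y s v = closedP-β v (closedP-e s)

  closedP-t-inner : ∀ s i j → Valid (t s (suc i) (suc j)) → ClosedP (t s (suc i) (suc j))
  closedP-t-inner s i j v = cycleP (sideL s i j) (γ-valid (t s (suc i) (suc j)) v)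

  closedP-t : ∀ s i j → Valid (t s i j) → ClosedP (t s i j)
  closedP-t s zero    j       v = closedP-β v λ v → closedP-δ v (closedP-y _)
  closedP-t s (suc i) (suc j) v = closedP-t-inner s i j v
  -- The zigzag through the last triangle reaches the triangle two steps back, which is inner
  -- because `spanL s` is at least 3.
  closedP-t s (suc (suc (suc i))) zero v =
    closedP-β v λ v → closedP-δ v λ v → closedP-β v λ v → closedP-δ v λ v →
    closedP-β v (closedP-t-inner _ _ _)
  closedP-t s (suc zero)          zero (_ , ())
  closedP-t s (suc (suc zero))    zero (_ , ())

  closedP-w : ∀ s → ValidStub s → ClosedP (w s)
  closedP-w s v = closedP-δ v λ v → closedP-β v λ v → closedP-δ v λ v →
    closedP-β v (closedP-t _ _ _)

  closedP-z : ∀ s i j → Valid (z s i j) → ClosedP (z s i j)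
  closedP-z s zero    j v = closedP-δ v (closedP-w s)
  closedP-z s (suc i) j v = closedP-δ v λ v → closedP-β v (closedP-t _ _ _)

  closedP-z′ : ∀ s i j → Valid (z′ s i j) → ClosedP (z′ s i j)
  closedP-z′ s zero    j v = closedP-δ v (closedP-t _ _ _)
  closedP-z′ s (suc i) j v = closedP-δ v λ v → closedP-β v (closedP-z′ _ i _)

  closedP : ∀ x → Valid x → ClosedP x
  closedP base       v = cycleP root v
  closedP (e s)      v = closedP-e s v
  closedP (y s)      v = closedP-y s v
  closedP (w s)      v = closedP-w s v
  closedP (z s i j)  v = closedP-z s i j v
  closedP (u s i j)  v = closedP-β v (closedP-t s i j)
  closedP (t s i j)  v = closedP-t s i j v
  closedP (z′ s i j) v = closedP-z′ s i j v
  closedP (u′ s i j) v = closedP-β v (cycleP (sideP s i j))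
  closedP (t′ s i j) v = cycleP (sideP s i j) v

  model : Model (11 + n)
  model = record
    { Flag = Flag ; Valid = Valid ; α = α ; β = β ; γ = γ
    ; α-valid = λ {x} → α-valid x ; β-valid = λ {x} → β-valid x ; γ-valid = λ {x} → γ-valid x
    ; αα≡id = αα≡id _ ; ββ≡id = ββ≡id _ ; γγ≡id = γγ≡id _
    ; αβ³≡id = αβ³≡id _ ; αγ²≡id = δδ≡id _
    ; βγᵈ≡id = λ {x} v → L.closed⇒βκᵈ (11 + n) v (closedL x v)
    ; βαγᵈ≡id = λ {x} v → P.closed⇒βκᵈ (11 + n) v (closedP x v)
    }

  -- The exact period at the initial flag

  base-orbit : ∀ i j → j + i ≡ 7 + n → fold base (β ∘ γ) (2 + i) ≡ z root j i
  -- The root segment has one turn and is its own mate, so the orbit goes from `y root` into a chain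
  -- of span `7 + n` and stays on its `z` flags.
  base-orbit zero    j p = cong (λ ● → z root ● 0) (trans (cong (3 +_) (+-comm n 4)) (trans (sym p) (+-identityʳ j)))
  base-orbit (suc i) j p = cong (β ∘ γ) (base-orbit i (suc j) (trans (sym (+-suc j i)) p))

  base-moves : ∀ k → 1 ≤ k → k < 11 + n → fold base (β ∘ γ) k ≢ base
  base-moves (suc zero)    _ _ ()
  base-moves (suc (suc i)) _ (s≤s (s≤s (s≤s i≤8+n))) eq with m≤n⇒m<n∨m≡n i≤8+n
  ... | inj₁ (s≤s i≤7+n) with () ← trans (sym (base-orbit i (7 + n ∸ i) (m∸n+n≡m i≤7+n))) eq
  -- This is the exponent `10 + n`, at which the orbit has left the chain and is at `e root`.
  ... | inj₂ refl        with () ← trans (sym (cong (β ∘ γ) (base-orbit (7 + n) 0 refl))) eq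

  uncollapsed-11+n : Uncollapsed (11 + n)
  uncollapsed-11+n = uncollapsed model λ k 1≤k k<d → base , tt , base-moves k 1≤k k<d

-- Combining the finite models with the free construction

theorem6p18 : ∀ (d : ℕ) → 5 ≤ d → d ≢ 7 → Uncollapsed d
theorem6p18 5 _ _ = uncollapsed-5
theorem6p18 6 _ _ = uncollapsed-6
theorem6p18 7 _ 7≢7 = ⊥-elim (7≢7 refl)
theorem6p18 8 _ _ = uncollapsed-8
theorem6p18 9 _ _ = uncollapsed-9
theorem6p18 10 _ _ = uncollapsed-10
theorem6p18 (suc (suc (suc (suc (suc (suc (suc (suc (suc (suc (suc n))))))))))) _ _ =
  FreeModel.uncollapsed-11+n n
theorem6p18 1 (s≤s ())
theorem6p18 2 (s≤s (s≤s ()))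
theorem6p18 3 (s≤s (s≤s (s≤s ())))
theorem6p18 4 (s≤s (s≤s (s≤s (s≤s ()))))
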